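{- Let $n\ge 1$ and $t\ge 1$ be integers. Every red-blue $K_n$ has at most $2n\left(\frac{n-1}{2}\right)^{t}$ alternating walks of length $t$. Equality is attained for colourings in which every vertex is incident with exactly $\frac{n-1}{2}$ red and $\frac{n-1}{2}$ blue edges.
   Context: A red-blue $K_n$ is a complete graph on $n$ vertices each of whose edges is coloured either red or blue. A walk of length $t$ is an ordered tuple $(v_0,v_1,\ldots,v_t)$ of vertices such that $v_{i-1}v_i$ is an edge for each $i\in\{1,\ldots,t\}$ (vertices may repeat; a walk and its reversal are different walks). A walk is alternating if $v_{i-1}v_i$ and $v_iv_{i+1}$ have different colours for each $i\in\{1,\ldots,t-1\}$. -}

module Defs where

open import Data.Nat using (ℕ; zero; suc)
open import Data.Bool using (Bool; true; false; not; _∧_)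
open import Data.Fin using (Fin)
open import Data.Fin.Properties using () renaming (_≟_ to _≟ᶠ_)
open import Data.List using (List; []; _∷_; map; concatMap; filter; length; allFin)
open import Data.Vec using (Vec; []; _∷_)
open import Relation.Nullary.Decidable using (⌊_⌋)
open import Data.Bool using (_≟_)
open import Relation.Binary.PropositionalEquality using (_≡_)

data Colour : Set where
  red blue : Colour

_≟ᶜ_ : (a b : Colour) → Bool
red  ≟ᶜ red  = true
blue ≟ᶜ blue = true
red  ≟ᶜ blue = false
blue ≟ᶜ red  = false

-- A colouring of the edges of K_n on vertex set Fin n: the colour of the
-- edge uv is c u v.  Values on the diagonal (u = v) are irrelevant, since
-- uu is not an edge of K_n.
Colouring : ℕ → Set
Colouring n = Fin n → Fin n → Colour

IsRedBlueKn : {n : ℕ} → Colouring n → Set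
IsRedBlueKn {n} c = (u v : Fin n) → c u v ≡ c v u

adj : {n : ℕ} → Fin n → Fin n → Bool
adj u v = not ⌊ u ≟ᶠ v ⌋

isAltWalk : {n k : ℕ} → Colouring n → Vec (Fin n) k → Bool
isAltWalk c [] = true
isAltWalk c (x ∷ []) = true
isAltWalk c (x ∷ y ∷ []) = adj x y
isAltWalk c (x ∷ w@(y ∷ z ∷ rest)) =
  adj x y ∧ not (c x y ≟ᶜ c y z) ∧ isAltWalk c w

allVecs : (n k : ℕ) → List (Vec (Fin n) k)
allVecs n zero = [] ∷ []
allVecs n (suc k) = concatMap (λ i → map (i ∷_) (allVecs n k)) (allFin n)

numAltWalks : {n : ℕ} → Colouring n → ℕ → ℕ
numAltWalks {n} c t = length (filter (λ w → isAltWalk c w ≟ true) (allVecs n (suc t)))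

degree : {n : ℕ} → Colouring n → Colour → Fin n → ℕ
degree {n} c col v = length (filter (λ u → (adj v u ∧ (c v u ≟ᶜ col)) ≟ true) (allFin n))

redDeg blueDeg : {n : ℕ} → Colouring n → Fin n → ℕ
redDeg c = degree c red
blueDeg c = degree c blue

{-# OPTIONS --safe #-}
-- An alternating walk is a walk in the digraph E on pairs (vertex, colour of the next edge).
-- There row sum + column sum = n - 1 =: N at every state, as these are the two colour degrees of
-- the vertex. Write A for the operator of E and Φ f = Σ colSum · f². AM-GM gives
-- 2⟨g, A f⟩ ≤ Σ rowSum · g² + Φ f; for the pair (2 A f, N f) this reads 4 Φ (A f) ≤ N² Φ f, and
-- for the pair (Nᵗ, 2ᵗ Aᵗ 1) it then bounds Nᵗ 2ᵗ⁺¹ ⟨1, Aᵗ⁺¹ 1⟩ by N²ᵗ · N · 2n.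
module Submission where

open import Defs
open import Data.Nat using (ℕ; zero; suc; _≤_; _+_; _*_; _^_; _∸_; z≤n; s≤s)
open import Data.Nat.Properties
open import Data.Nat.Solver using (module +-*-Solver)
open import Data.Bool using (Bool; true; false; not; _∧_) renaming (_≟_ to _≟ᵇ_)
open import Data.Fin using (Fin; zero; suc)
open import Data.Fin.Properties using () renaming (_≟_ to _≟ᶠ_)
open import Data.List using (List; []; _∷_; _++_; map; concatMap; filter; length; allFin; tabulate)
open import Data.List.Properties using (length-tabulate)
open import Data.Vec using (Vec; []; _∷_)
open import Data.Product using (_×_; _,_; proj₁; proj₂)
open import Data.Sum using (inj₁; inj₂)
open import Function using (_∘_; id)
open import Relation.Nullary.Decidable using (⌊_⌋; yes; no; isYes≗does)
open import Relation.Binary.PropositionalEquality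
  using (_≡_; refl; sym; trans; cong; cong₂; subst; subst₂; module ≡-Reasoning)

open +-*-Solver using (solve; _:+_; _:*_; _:=_; con)

private variable
  S T : Set

-- Finite sums of natural numbers over lists.

∑ : List S → (S → ℕ) → ℕ
∑ []       f = 0
∑ (x ∷ xs) f = f x + ∑ xs f

∑-cong : ∀ (xs : List S) {f g : S → ℕ} → (∀ x → f x ≡ g x) → ∑ xs f ≡ ∑ xs g
∑-cong []       h = refl
∑-cong (x ∷ xs) h = cong₂ _+_ (h x) (∑-cong xs h)

∑-mono : ∀ (xs : List S) {f g : S → ℕ} → (∀ x → f x ≤ g x) → ∑ xs f ≤ ∑ xs g
∑-mono []       h = z≤n
∑-mono (x ∷ xs) h = +-mono-≤ (h x) (∑-mono xs h)

∑-distrib-+ : ∀ (xs : List S) (f g : S → ℕ) → ∑ xs (λ x → f x + g x) ≡ ∑ xs f + ∑ xs g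
∑-distrib-+ []       f g = refl
∑-distrib-+ (x ∷ xs) f g rewrite ∑-distrib-+ xs f g =
  solve 4 (λ a b p q → a :+ b :+ (p :+ q) := a :+ p :+ (b :+ q)) refl (f x) (g x) (∑ xs f) (∑ xs g)

∑-*ˡ : ∀ (xs : List S) k (f : S → ℕ) → ∑ xs (λ x → k * f x) ≡ k * ∑ xs f
∑-*ˡ []       k f = sym (*-zeroʳ k)
∑-*ˡ (x ∷ xs) k f rewrite ∑-*ˡ xs k f = sym (*-distribˡ-+ k (f x) (∑ xs f))

∑-*ʳ : ∀ (xs : List S) k (f : S → ℕ) → ∑ xs (λ x → f x * k) ≡ ∑ xs f * k
∑-*ʳ xs k f = trans (∑-cong xs (λ x → *-comm (f x) k)) (trans (∑-*ˡ xs k f) (*-comm k (∑ xs f)))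

∑-const : ∀ (xs : List S) k → ∑ xs (λ _ → k) ≡ length xs * k
∑-const []       k = refl
∑-const (x ∷ xs) k = cong (k +_) (∑-const xs k)

∑-swap : ∀ (xs : List S) (ys : List T) (f : S → T → ℕ) →
         ∑ xs (λ x → ∑ ys (f x)) ≡ ∑ ys (λ y → ∑ xs (λ x → f x y))
∑-swap []       ys f = sym (trans (∑-const ys 0) (*-zeroʳ (length ys)))
∑-swap (x ∷ xs) ys f =
  trans (cong (∑ ys (f x) +_) (∑-swap xs ys f)) (sym (∑-distrib-+ ys (f x) _))

∑-++ : ∀ (xs ys : List S) (f : S → ℕ) → ∑ (xs ++ ys) f ≡ ∑ xs f + ∑ ys f
∑-++ []       ys f = refl
∑-++ (x ∷ xs) ys f rewrite ∑-++ xs ys f = sym (+-assoc (f x) _ _)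

∑-map : ∀ (k : S → T) (xs : List S) (f : T → ℕ) → ∑ (map k xs) f ≡ ∑ xs (f ∘ k)
∑-map k []       f = refl
∑-map k (x ∷ xs) f = cong (f (k x) +_) (∑-map k xs f)

∑-concatMap : ∀ (k : S → List T) (xs : List S) (f : T → ℕ) →
              ∑ (concatMap k xs) f ≡ ∑ xs (λ x → ∑ (k x) f)
∑-concatMap k []       f = refl
∑-concatMap k (x ∷ xs) f =
  trans (∑-++ (k x) (concatMap k xs) f) (cong (∑ (k x) f +_) (∑-concatMap k xs f))

-- The tail of `allFin (suc n)` is a tabulation of `suc`, not an `allFin`; reindexing it as a sum
-- over `allFin n` makes induction on `n` possible.
∑-tabulate : ∀ {n} (k : Fin n → S) (f : S → ℕ) → ∑ (tabulate k) f ≡ ∑ (allFin n) (f ∘ k)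
∑-tabulate {n = zero}  k f = refl
∑-tabulate {n = suc n} k f = cong (f (k zero) +_)
  (trans (∑-tabulate (k ∘ suc) f) (sym (∑-tabulate suc (f ∘ k))))

-- Indicators, and counting by filtering.

⟦_⟧ : Bool → ℕ
⟦ true  ⟧ = 1
⟦ false ⟧ = 0

⟦∧⟧ : ∀ a b → ⟦ a ∧ b ⟧ ≡ ⟦ a ⟧ * ⟦ b ⟧
⟦∧⟧ true  b = sym (*-identityˡ ⟦ b ⟧)
⟦∧⟧ false b = refl

length-filter-∑ : ∀ (p : S → Bool) xs →
                  length (filter (λ x → p x ≟ᵇ true) xs) ≡ ∑ xs (λ x → ⟦ p x ⟧)
length-filter-∑ p [] = refl
length-filter-∑ p (x ∷ xs) with p x
... | true  = cong suc (length-filter-∑ p xs)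
... | false = length-filter-∑ p xs

-- Subtraction on `ℕ` is truncated, so the larger number is written as the smaller plus `d`; the two
-- sides then differ by exactly `d * d`.
2ab≤a²+b² : ∀ a b → 2 * (a * b) ≤ a * a + b * b
2ab≤a²+b² a b with ≤-total a b
... | inj₁ a≤b = subst (λ b → 2 * (a * b) ≤ a * a + b * b) (m+[n∸m]≡n a≤b) (ordered a (b ∸ a))
  where
  ordered : ∀ a d → 2 * (a * (a + d)) ≤ a * a + (a + d) * (a + d)
  ordered a d = ≤-trans (m≤m+n _ (d * d)) (≤-reflexive
    (solve 2 (λ a d → con 2 :* (a :* (a :+ d)) :+ d :* d := a :* a :+ (a :+ d) :* (a :+ d)) refl a d))
... | inj₂ b≤a = subst (λ a → 2 * (a * b) ≤ a * a + b * b) (m+[n∸m]≡n b≤a) (ordered b (a ∸ b))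
  where
  ordered : ∀ b d → 2 * ((b + d) * b) ≤ (b + d) * (b + d) + b * b
  ordered b d = ≤-trans (m≤m+n _ (d * d)) (≤-reflexive
    (solve 2 (λ b d → con 2 :* ((b :+ d) :* b) :+ d :* d := (b :+ d) :* (b :+ d) :+ b :* b) refl b d))

-- Walks in a finite digraph with arc weights in `ℕ`.

module Digraph (xs : List S) (E : S → S → ℕ) where

  rowSum colSum : S → ℕ
  rowSum s = ∑ xs (E s)
  colSum s = ∑ xs (λ r → E r s)

  A : (S → ℕ) → S → ℕ
  A f s = ∑ xs (λ r → E s r * f r)

  -- This is `A` applied `t` times to the constant 1. When `E` is the indicator of an arc, it counts
  -- the walks with `t` arcs that start at `s`.
  walks : ℕ → S → ℕ
  walks zero    s = 1
  walks (suc t) s = A (walks t) s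

  Φ : (S → ℕ) → ℕ
  Φ f = ∑ xs (λ s → colSum s * (f s * f s))

  A-*ˡ : ∀ k f s → A (λ r → k * f r) s ≡ k * A f s
  A-*ˡ k f s = trans
    (∑-cong xs (λ r → solve 3 (λ e k f → e :* (k :* f) := k :* (e :* f)) refl (E s r) k (f r)))
    (∑-*ˡ xs k _)

  A-const : ∀ k s → A (λ _ → k) s ≡ rowSum s * k
  A-const k s = ∑-*ʳ xs k (E s)

  Φ-*ˡ : ∀ k f → Φ (λ s → k * f s) ≡ k * k * Φ f
  Φ-*ˡ k f = trans
    (∑-cong xs (λ s → solve 3 (λ c k f → c :* (k :* f :* (k :* f)) := k :* k :* (c :* (f :* f))) refl
      (colSum s) k (f s)))
    (∑-*ˡ xs (k * k) _)

  -- AM-GM is applied on each arc from `s` to `r`, with `g` read at the tail and `f` at the head.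
  -- Collecting the squares of `g` by tails produces row sums; swapping the order of summation and
  -- collecting the squares of `f` by heads produces column sums.
  bilinear-bound : ∀ (f g : S → ℕ) →
    2 * ∑ xs (λ s → g s * A f s) ≤ ∑ xs (λ s → rowSum s * (g s * g s)) + Φ f
  bilinear-bound f g = begin
    2 * ∑ xs (λ s → g s * A f s)
      ≡⟨ ∑-*ˡ xs 2 (λ s → g s * A f s) ⟨
    ∑ xs (λ s → 2 * (g s * A f s))
      ≡⟨ ∑-cong xs expand ⟩
    ∑ xs (λ s → ∑ xs (λ r → E s r * (2 * (g s * f r))))
      ≤⟨ ∑-mono xs (λ s → ∑-mono xs (λ r → *-monoʳ-≤ (E s r) (2ab≤a²+b² (g s) (f r)))) ⟩
    ∑ xs (λ s → ∑ xs (λ r → E s r * (g s * g s + f r * f r)))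
      ≡⟨ ∑-cong xs split ⟩
    ∑ xs (λ s → rowSum s * (g s * g s) + ∑ xs (λ r → E s r * (f r * f r)))
      ≡⟨ ∑-distrib-+ xs (λ s → rowSum s * (g s * g s))
           (λ s → ∑ xs (λ r → E s r * (f r * f r))) ⟩
    ∑ xs (λ s → rowSum s * (g s * g s)) + ∑ xs (λ s → ∑ xs (λ r → E s r * (f r * f r)))
      ≡⟨ cong (∑ xs (λ s → rowSum s * (g s * g s)) +_)
           (trans (∑-swap xs xs (λ s r → E s r * (f r * f r)))
             (∑-cong xs (λ r → ∑-*ʳ xs (f r * f r) (λ s → E s r)))) ⟩
    ∑ xs (λ s → rowSum s * (g s * g s)) + Φ f ∎
    where
    open ≤-Reasoning
    expand : ∀ s → 2 * (g s * A f s) ≡ ∑ xs (λ r → E s r * (2 * (g s * f r)))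
    expand s = trans (sym (*-assoc 2 (g s) (A f s))) (trans (sym (∑-*ˡ xs (2 * g s) (λ r → E s r * f r)))
      (∑-cong xs (λ r →
      solve 3 (λ g e f → con 2 :* g :* (e :* f) := e :* (con 2 :* (g :* f))) refl (g s) (E s r) (f r))))
    split : ∀ s → ∑ xs (λ r → E s r * (g s * g s + f r * f r))
                ≡ rowSum s * (g s * g s) + ∑ xs (λ r → E s r * (f r * f r))
    split s = trans (∑-cong xs (λ r → *-distribˡ-+ (E s r) (g s * g s) (f r * f r)))
      (trans (∑-distrib-+ xs (λ r → E s r * (g s * g s)) (λ r → E s r * (f r * f r)))
        (cong (_+ ∑ xs (λ r → E s r * (f r * f r))) (∑-*ʳ xs (g s * g s) (E s))))

  -- Upper bounds when row sum plus column sum is the same at every vertex.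

  module _ {N : ℕ} (row+col : ∀ s → rowSum s + colSum s ≡ N) where

    -- Writing `N` as `rowSum s + colSum s` on the left of the bilinear bound splits it into two
    -- parts. The row part is exactly the row term on the right and cancels; the column part is
    -- `4 * Φ (A f)`.
    Φ-A-decay : ∀ f → 4 * Φ (A f) ≤ N * N * Φ f
    Φ-A-decay f = +-cancelˡ-≤ R _ _ (begin
      R + 4 * Φ (A f)                                  ≡⟨ lhs ⟨
      -- With `k * A f` in the first slot, the row parts carry the coefficients `2 * k` and `k * k`;
      -- they agree for `k = 2`.
      2 * ∑ xs (λ s → 2 * A f s * A (λ r → N * f r) s) ≤⟨ bilinear-bound (λ r → N * f r) (λ s → 2 * A f s) ⟩
      R + Φ (λ r → N * f r)                            ≡⟨ cong (R +_) (Φ-*ˡ N f) ⟩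
      R + N * N * Φ f                                  ∎)
      where
      open ≤-Reasoning
      R = ∑ xs (λ s → rowSum s * (2 * A f s * (2 * A f s)))
      pointwise : ∀ s → 2 * (2 * A f s * A (λ r → N * f r) s)
                      ≡ rowSum s * (2 * A f s * (2 * A f s)) + 4 * (colSum s * (A f s * A f s))
      pointwise s rewrite A-*ˡ N f s | sym (row+col s) =
        solve 3 (λ a p q → con 2 :* (con 2 :* a :* ((p :+ q) :* a))
                        := p :* (con 2 :* a :* (con 2 :* a)) :+ con 4 :* (q :* (a :* a)))
          refl (A f s) (rowSum s) (colSum s)
      lhs : 2 * ∑ xs (λ s → 2 * A f s * A (λ r → N * f r) s) ≡ R + 4 * Φ (A f)
      lhs = trans (sym (∑-*ˡ xs 2 (λ s → 2 * A f s * A (λ r → N * f r) s))) (trans (∑-cong xs pointwise)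
        (trans (∑-distrib-+ xs _ (λ s → 4 * (colSum s * (A f s * A f s))))
          (cong (R +_) (∑-*ˡ xs 4 (λ s → colSum s * (A f s * A f s))))))

    -- Each application of `A` costs at most a factor (N/2)². The denominators are cleared, and the
    -- powers are kept as squares of `2 ^ t` and `N ^ t` to match the scalings used in the next
    -- bound.
    Φ-walks : ∀ t → 2 ^ t * 2 ^ t * Φ (walks t) ≤ N ^ t * N ^ t * Φ (walks 0)
    Φ-walks zero    = ≤-refl
    Φ-walks (suc t) = begin
      2 * p * (2 * p) * Φ (walks (suc t))
        ≡⟨ solve 2 (λ p x → con 2 :* p :* (con 2 :* p) :* x := p :* p :* (con 4 :* x)) refl p (Φ (walks (suc t))) ⟩
      p * p * (4 * Φ (walks (suc t)))
        ≤⟨ *-monoʳ-≤ (p * p) (Φ-A-decay (walks t)) ⟩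
      p * p * (N * N * Φ (walks t))
        ≡⟨ solve 3 (λ p n x → p :* p :* (n :* n :* x) := n :* n :* (p :* p :* x)) refl p N (Φ (walks t)) ⟩
      N * N * (p * p * Φ (walks t))
        ≤⟨ *-monoʳ-≤ (N * N) (Φ-walks t) ⟩
      N * N * (q * q * Φ (walks 0))
        ≡⟨ solve 3 (λ n q x → n :* n :* (q :* q :* x) := n :* q :* (n :* q) :* x) refl N q (Φ (walks 0)) ⟩
      N * q * (N * q) * Φ (walks 0) ∎
      where
      open ≤-Reasoning
      p = 2 ^ t
      q = N ^ t

    -- The constant `N ^ t` is paired with `2 ^ t * walks t` because the two coincide when every row
    -- sum is N/2, so AM-GM loses nothing in the extremal case. The price is an extra factor `N ^ t`
    -- on both sides.
    walks-bound-scaled : ∀ t →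
      N ^ t * (2 ^ suc t * ∑ xs (walks (suc t))) ≤ N ^ t * (length xs * N ^ suc t)
    walks-bound-scaled t = begin
      q * (2 * p * ∑ xs (walks (suc t)))
        ≡⟨ solve 3 (λ q p x → q :* (con 2 :* p :* x) := con 2 :* (q :* p :* x)) refl q p (∑ xs (walks (suc t))) ⟩
      2 * (q * p * ∑ xs (walks (suc t)))
        ≡⟨ cong (2 *_) (sym (trans
             (∑-cong xs (λ s → trans (cong (q *_) (A-*ˡ p (walks t) s)) (sym (*-assoc q p (A (walks t) s)))))
             (∑-*ˡ xs (q * p) (walks (suc t))))) ⟩
      2 * ∑ xs (λ s → q * A (λ r → p * walks t r) s)
        ≤⟨ bilinear-bound (λ r → p * walks t r) (λ _ → q) ⟩
      ∑ xs (λ s → rowSum s * (q * q)) + Φ (λ r → p * walks t r)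
        ≡⟨ cong₂ _+_ (∑-*ʳ xs (q * q) rowSum) (Φ-*ˡ p (walks t)) ⟩
      ∑ xs rowSum * (q * q) + p * p * Φ (walks t)
        ≤⟨ +-monoʳ-≤ (∑ xs rowSum * (q * q)) (Φ-walks t) ⟩
      ∑ xs rowSum * (q * q) + q * q * Φ (walks 0)
        ≡⟨ solve 3 (λ r q x → r :* (q :* q) :+ q :* q :* x := q :* q :* (r :+ x)) refl (∑ xs rowSum) q _ ⟩
      q * q * (∑ xs rowSum + Φ (walks 0))
        -- Since `walks 0` is constantly 1, `Φ (walks 0)` is the sum of all column sums, and row and
        -- column sums together give `N` per vertex.
        ≡⟨ cong (q * q *_) total ⟩
      q * q * (length xs * N)
        ≡⟨ solve 3 (λ q l n → q :* q :* (l :* n) := q :* (l :* (n :* q))) refl q (length xs) N ⟩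
      q * (length xs * (N * q)) ∎
      where
      open ≤-Reasoning
      p = 2 ^ t
      q = N ^ t
      total : ∑ xs rowSum + Φ (walks 0) ≡ length xs * N
      total = trans (sym (∑-distrib-+ xs rowSum (λ s → colSum s * 1))) (trans
        (∑-cong xs (λ s → trans (cong (rowSum s +_) (*-identityʳ (colSum s))) (row+col s)))
        (∑-const xs N))

  walks-bound : ∀ {N} → (∀ s → rowSum s + colSum s ≡ N) → ∀ t →
    2 ^ suc t * ∑ xs (walks (suc t)) ≤ length xs * N ^ suc t
  walks-bound {suc N} row+col t =
    *-cancelˡ-≤ (suc N ^ t) ⦃ m^n≢0 (suc N) t ⦄ (walks-bound-scaled row+col t)
  -- With N = 0 the scaled bound reads 0 ≤ 0 once t > 0, so this case needs its own argument.
  walks-bound {zero}  row+col t = begin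
    2 ^ suc t * ∑ xs (walks (suc t))
      ≡⟨ solve 2 (λ p x → con 2 :* p :* x := p :* (con 2 :* x)) refl (2 ^ t) (∑ xs (walks (suc t))) ⟩
    2 ^ t * (2 * ∑ xs (walks (suc t)))
      ≡⟨ cong (λ x → 2 ^ t * (2 * x)) (∑-cong xs (λ s → sym (*-identityˡ (A (walks t) s)))) ⟩
    2 ^ t * (2 * ∑ xs (λ s → 1 * A (walks t) s))
      ≤⟨ *-monoʳ-≤ (2 ^ t) (bilinear-bound (walks t) (λ _ → 1)) ⟩
    2 ^ t * (∑ xs (λ s → rowSum s * 1) + Φ (walks t))
      ≡⟨ cong (2 ^ t *_) (cong₂ _+_
           (vanish (λ s → cong (_* 1) (m+n≡0⇒m≡0 (rowSum s) (row+col s))))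
           (vanish (λ s → cong (_* (walks t s * walks t s)) (m+n≡0⇒n≡0 (rowSum s) (row+col s))))) ⟩
    2 ^ t * 0
      ≡⟨ *-zeroʳ (2 ^ t) ⟩
    0
      ≤⟨ z≤n ⟩
    length xs * 0 ^ suc t ∎
    where
    open ≤-Reasoning
    vanish : ∀ {f : S → ℕ} → (∀ s → f s ≡ 0) → ∑ xs f ≡ 0
    vanish h = trans (∑-cong xs h) (trans (∑-const xs 0) (*-zeroʳ (length xs)))

  -- Exact walk counts when all row sums are equal.

  -- If every row sum is N/2, then `A` sends constant functions to constant functions, multiplying
  -- them by N/2; the powers of 2 clear the denominators.
  walks-regular : ∀ {N} → (∀ s → 2 * rowSum s ≡ N) → ∀ t s → 2 ^ t * walks t s ≡ N ^ t
  walks-regular     reg zero    s = refl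
  walks-regular {N} reg (suc t) s = begin
    2 * 2 ^ t * A (walks t) s           ≡⟨ *-assoc 2 (2 ^ t) (A (walks t) s) ⟩
    2 * (2 ^ t * A (walks t) s)         ≡⟨ cong (2 *_) (A-*ˡ (2 ^ t) (walks t) s) ⟨
    2 * A (λ r → 2 ^ t * walks t r) s   ≡⟨ cong (2 *_) (∑-cong xs (λ r →
                                             cong (E s r *_) (walks-regular reg t r))) ⟩
    2 * A (λ _ → N ^ t) s               ≡⟨ cong (2 *_) (A-const (N ^ t) s) ⟩
    2 * (rowSum s * N ^ t)              ≡⟨ *-assoc 2 (rowSum s) (N ^ t) ⟨
    2 * rowSum s * N ^ t                ≡⟨ cong (_* N ^ t) (reg s) ⟩
    N * N ^ t                           ∎
    where open ≡-Reasoning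

-- Colours, and the number of neighbours of a vertex in a complete graph.

opposite : Colour → Colour
opposite red  = blue
opposite blue = red

∑-≟ : ∀ {n} (v : Fin n) → ∑ (allFin n) (λ u → ⟦ ⌊ v ≟ᶠ u ⌋ ⟧) ≡ 1
∑-≟ {suc n} zero    = cong suc (trans (∑-tabulate {n = n} suc _)
  (trans (∑-const (allFin n) 0) (*-zeroʳ (length (allFin n)))))
-- The decisions for `suc v`, `suc u` and for `v`, `u` have the same `does` by definition but carry
-- different proofs, so the comparison passes through `does`.
∑-≟ {suc n} (suc v) = trans (∑-tabulate {n = n} suc _) (trans (∑-cong (allFin n) (λ u → cong ⟦_⟧
  (trans (isYes≗does (suc v ≟ᶠ suc u)) (sym (isYes≗does (v ≟ᶠ u)))))) (∑-≟ v))

-- Adding the indicator of `v` itself makes every summand 1, for a total of `n`. The truncated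
-- subtraction is exact because it acts on `a + 1`.
∑-adj : ∀ {n} (v : Fin n) → ∑ (allFin n) (λ u → ⟦ adj v u ⟧) ≡ n ∸ 1
∑-adj {n} v = begin
  a              ≡⟨ m+n∸n≡m a 1 ⟨
  a + 1 ∸ 1      ≡⟨ cong (λ x → a + x ∸ 1) (∑-≟ v) ⟨
  a + ∑ (allFin n) (λ u → ⟦ ⌊ v ≟ᶠ u ⌋ ⟧) ∸ 1
                 ≡⟨ cong (_∸ 1) (sym (∑-distrib-+ (allFin n) (λ u → ⟦ adj v u ⟧) _)) ⟩
  ∑ (allFin n) (λ u → ⟦ adj v u ⟧ + ⟦ ⌊ v ≟ᶠ u ⌋ ⟧) ∸ 1
                 ≡⟨ cong (_∸ 1) (∑-cong (allFin n) (λ u → complement ⌊ v ≟ᶠ u ⌋)) ⟩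
  ∑ (allFin n) (λ _ → 1) ∸ 1
                 ≡⟨ cong (_∸ 1) (trans (∑-const (allFin n) 1) (trans (*-identityʳ _) (length-tabulate {n = n} id))) ⟩
  n ∸ 1 ∎
  where
  open ≡-Reasoning
  a = ∑ (allFin n) (λ u → ⟦ adj v u ⟧)
  complement : ∀ b → ⟦ not b ⟧ + ⟦ b ⟧ ≡ 1
  complement true  = refl
  complement false = refl

adj-sym : ∀ {n} (u v : Fin n) → adj u v ≡ adj v u
adj-sym u v with u ≟ᶠ v | v ≟ᶠ u
... | yes _ | yes _ = refl
... | no  _ | no  _ = refl
... | yes p | no  q with () ← q (sym p)
... | no  p | yes q with () ← p (sym q)

-- The state digraph of a colouring and its row and column sums.

module Alternating {n : ℕ} (c : Colouring n) where

  edge : Colour → Fin n → Fin n → ℕ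
  edge col v w = ⟦ adj v w ∧ (c v w ≟ᶜ col) ⟧

  State : Set
  State = Fin n × Colour

  states : List State
  states = concatMap (λ v → (v , red) ∷ (v , blue) ∷ []) (allFin n)

  -- An arc traverses an edge `vw` of colour `col` and thereby fixes the colour that the edge after
  -- it must have.
  E : State → State → ℕ
  E (v , col) (w , col′) = edge col v w * ⟦ col′ ≟ᶜ opposite col ⟧

  open Digraph states E public

  ∑-states : ∀ f → ∑ states f ≡ ∑ (allFin n) (λ v → f (v , red) + f (v , blue))
  ∑-states f = trans (∑-concatMap _ (allFin n) f)
    (∑-cong (allFin n) (λ v → cong (f (v , red) +_) (+-identityʳ _)))

  length-states : length states ≡ 2 * n
  length-states = begin
    length states               ≡⟨ *-identityʳ _ ⟨
    length states * 1           ≡⟨ ∑-const states 1 ⟨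
    ∑ states (λ _ → 1)          ≡⟨ ∑-states (λ _ → 1) ⟩
    ∑ (allFin n) (λ _ → 2)      ≡⟨ ∑-const (allFin n) 2 ⟩
    length (allFin n) * 2       ≡⟨ cong (_* 2) (length-tabulate {n = n} id) ⟩
    n * 2                       ≡⟨ *-comm n 2 ⟩
    2 * n                       ∎
    where open ≡-Reasoning

  -- Of the two states over `w`, only the one whose colour is opposite to `col` can be the head of
  -- an arc from `(v , col)`.
  A-states : ∀ f v col → A f (v , col) ≡ ∑ (allFin n) (λ w → edge col v w * f (w , opposite col))
  A-states f v col = trans (∑-states _) (∑-cong (allFin n) (λ w → select col (edge col v w) w))
    where
    select : ∀ col e w → e * ⟦ red ≟ᶜ opposite col ⟧ * f (w , red)
                         + e * ⟦ blue ≟ᶜ opposite col ⟧ * f (w , blue)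
                       ≡ e * f (w , opposite col)
    select red  e w = solve 3 (λ e x y → e :* con 0 :* x :+ e :* con 1 :* y := e :* y)
      refl e (f (w , red)) (f (w , blue))
    select blue e w = solve 3 (λ e x y → e :* con 1 :* x :+ e :* con 0 :* y := e :* x)
      refl e (f (w , red)) (f (w , blue))

  degree-∑ : ∀ col v → degree c col v ≡ ∑ (allFin n) (edge col v)
  degree-∑ col v = length-filter-∑ _ (allFin n)

  rowSum-degree : ∀ v col → rowSum (v , col) ≡ degree c col v
  rowSum-degree v col = begin
    rowSum (v , col)                       ≡⟨ ∑-cong states (λ s → sym (*-identityʳ _)) ⟩
    A (λ _ → 1) (v , col)                  ≡⟨ A-states _ v col ⟩
    ∑ (allFin n) (λ w → edge col v w * 1)  ≡⟨ ∑-cong (allFin n) (λ w → *-identityʳ _) ⟩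
    ∑ (allFin n) (edge col v)              ≡⟨ degree-∑ col v ⟨
    degree c col v                         ∎
    where open ≡-Reasoning

  -- An arc into `(w , col)` has just traversed an edge of the opposite colour ending at `w`;
  -- symmetry of the colouring lets that edge be counted from `w`.
  colSum-degree : IsRedBlueKn c → ∀ w col → colSum (w , col) ≡ degree c (opposite col) w
  colSum-degree symm w col = begin
    colSum (w , col)
      ≡⟨ ∑-states _ ⟩
    ∑ (allFin n) (λ v → edge red v w * ⟦ col ≟ᶜ blue ⟧ + edge blue v w * ⟦ col ≟ᶜ red ⟧)
      ≡⟨ ∑-cong (allFin n) (λ v → select col v) ⟩
    ∑ (allFin n) (λ v → edge (opposite col) v w)
      ≡⟨ ∑-cong (allFin n) (λ v → cong₂ (λ a b → ⟦ a ∧ (b ≟ᶜ opposite col) ⟧) (adj-sym v w) (symm v w)) ⟩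
    ∑ (allFin n) (edge (opposite col) w)
      ≡⟨ degree-∑ (opposite col) w ⟨
    degree c (opposite col) w ∎
    where
    open ≡-Reasoning
    select : ∀ col v → edge red v w * ⟦ col ≟ᶜ blue ⟧ + edge blue v w * ⟦ col ≟ᶜ red ⟧ ≡ edge (opposite col) v w
    select red  v = solve 2 (λ x y → x :* con 0 :+ y :* con 1 := y)
      refl (edge red v w) (edge blue v w)
    select blue v = solve 2 (λ x y → x :* con 1 :+ y :* con 0 := x)
      refl (edge red v w) (edge blue v w)

  red+blue-degree : ∀ v → redDeg c v + blueDeg c v ≡ n ∸ 1
  red+blue-degree v = begin
    redDeg c v + blueDeg c v
      ≡⟨ cong₂ _+_ (degree-∑ red v) (degree-∑ blue v) ⟩
    ∑ (allFin n) (edge red v) + ∑ (allFin n) (edge blue v)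
      ≡⟨ ∑-distrib-+ (allFin n) _ _ ⟨
    ∑ (allFin n) (λ u → edge red v u + edge blue v u)
      ≡⟨ ∑-cong (allFin n) (λ u → either (adj v u) (c v u)) ⟩
    ∑ (allFin n) (λ u → ⟦ adj v u ⟧)
      ≡⟨ ∑-adj v ⟩
    n ∸ 1 ∎
    where
    open ≡-Reasoning
    either : ∀ a x → ⟦ a ∧ (x ≟ᶜ red) ⟧ + ⟦ a ∧ (x ≟ᶜ blue) ⟧ ≡ ⟦ a ⟧
    either true  red  = refl
    either true  blue = refl
    either false _    = refl

  row+col-sum : IsRedBlueKn c → ∀ s → rowSum s + colSum s ≡ n ∸ 1
  row+col-sum symm (v , red) =
    trans (cong₂ _+_ (rowSum-degree v red) (colSum-degree symm v red)) (red+blue-degree v)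
  row+col-sum symm (v , blue) =
    trans (cong₂ _+_ (rowSum-degree v blue) (colSum-degree symm v blue))
      (trans (+-comm (blueDeg c v) _) (red+blue-degree v))

  -- Alternating walks as walks in the state digraph.

  ∑-allVecs : ∀ k (f : Vec (Fin n) (suc k) → ℕ) →
              ∑ (allVecs n (suc k)) f ≡ ∑ (allFin n) (λ x → ∑ (allVecs n k) (λ w → f (x ∷ w)))
  ∑-allVecs k f = trans (∑-concatMap _ (allFin n) f)
    (∑-cong (allFin n) (λ x → ∑-map (x ∷_) (allVecs n k) f))

  -- Once the first edge `xy` is fixed, the colour of the next edge is forced, so the continuations
  -- correspond to the walks with `t` arcs from a single state over `y`.
  walks-from-edge : ∀ t x y →
    ∑ (allVecs n t) (λ w → ⟦ isAltWalk c (x ∷ y ∷ w) ⟧) ≡ ⟦ adj x y ⟧ * walks t (y , opposite (c x y))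
  walks-from-edge zero    x y = trans (+-identityʳ _) (sym (*-identityʳ _))
  walks-from-edge (suc t) x y = begin
    ∑ (allVecs n (suc t)) (λ w → ⟦ isAltWalk c (x ∷ y ∷ w) ⟧)
      ≡⟨ ∑-allVecs t _ ⟩
    ∑ (allFin n) (λ z → ∑ (allVecs n t) (λ w →
      ⟦ adj x y ∧ not (c x y ≟ᶜ c y z) ∧ isAltWalk c (y ∷ z ∷ w) ⟧))
      ≡⟨ ∑-cong (allFin n) (λ z → trans
           (∑-cong (allVecs n t) (λ w → trans (⟦∧⟧ (adj x y) _)
             (cong (⟦ adj x y ⟧ *_) (⟦∧⟧ (not (c x y ≟ᶜ c y z)) _))))
           (trans (∑-*ˡ (allVecs n t) ⟦ adj x y ⟧ _) (cong (⟦ adj x y ⟧ *_) (step z)))) ⟩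
    ∑ (allFin n) (λ z → ⟦ adj x y ⟧ * (edge d y z * walks t (z , opposite d)))
      ≡⟨ ∑-*ˡ (allFin n) ⟦ adj x y ⟧ _ ⟩
    ⟦ adj x y ⟧ * ∑ (allFin n) (λ z → edge d y z * walks t (z , opposite d))
      ≡⟨ cong (⟦ adj x y ⟧ *_) (A-states (walks t) y d) ⟨
    ⟦ adj x y ⟧ * walks (suc t) (y , d) ∎
    where
    open ≡-Reasoning
    d = opposite (c x y)
    -- If `a` and `e` are equal, both sides vanish; otherwise `e` is the opposite of `a`, and the
    -- two states over `z` coincide.
    alternate : ∀ a e z b → ⟦ not (a ≟ᶜ e) ⟧ * (⟦ b ⟧ * walks t (z , opposite e))
                          ≡ ⟦ b ∧ (e ≟ᶜ opposite a) ⟧ * walks t (z , opposite (opposite a))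
    alternate red  red  z true  = refl
    alternate red  red  z false = refl
    alternate red  blue z true  = *-identityˡ (1 * walks t (z , red))
    alternate red  blue z false = refl
    alternate blue red  z true  = *-identityˡ (1 * walks t (z , blue))
    alternate blue red  z false = refl
    alternate blue blue z true  = refl
    alternate blue blue z false = refl
    step : ∀ z → ∑ (allVecs n t) (λ w → ⟦ not (c x y ≟ᶜ c y z) ⟧ * ⟦ isAltWalk c (y ∷ z ∷ w) ⟧)
               ≡ edge d y z * walks t (z , opposite d)
    step z = trans (∑-*ˡ (allVecs n t) ⟦ not (c x y ≟ᶜ c y z) ⟧ _)
      (trans (cong (⟦ not (c x y ≟ᶜ c y z) ⟧ *_) (walks-from-edge t y z))
        (alternate (c x y) (c y z) z (adj y z)))

  -- The colour of its first edge determines the state in which an alternating walk starts. This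
  -- takes at least one edge: a walk of length 0 would be counted at both states over its vertex.
  numAltWalks-∑ : ∀ t → numAltWalks c (suc t) ≡ ∑ states (walks (suc t))
  numAltWalks-∑ t = begin
    numAltWalks c (suc t)
      ≡⟨ length-filter-∑ (isAltWalk c) (allVecs n (suc (suc t))) ⟩
    ∑ (allVecs n (suc (suc t))) (λ w → ⟦ isAltWalk c w ⟧)
      ≡⟨ trans (∑-allVecs (suc t) _) (∑-cong (allFin n) (λ x → ∑-allVecs t _)) ⟩
    ∑ (allFin n) (λ x → ∑ (allFin n) (λ y → ∑ (allVecs n t) (λ w → ⟦ isAltWalk c (x ∷ y ∷ w) ⟧)))
      -- The walks are sorted by the colour of their first edge, which yields one term for each
      -- state over `x`.
      ≡⟨ ∑-cong (allFin n) (λ x → ∑-cong (allFin n) (λ y →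
           trans (walks-from-edge t x y) (byColour (adj x y) (c x y) y))) ⟩
    ∑ (allFin n) (λ x → ∑ (allFin n) (λ y → edge red x y * walks t (y , blue) + edge blue x y * walks t (y , red)))
      ≡⟨ ∑-cong (allFin n) (λ x → trans (∑-distrib-+ (allFin n) _ _)
           (sym (cong₂ _+_ (A-states (walks t) x red) (A-states (walks t) x blue)))) ⟩
    ∑ (allFin n) (λ x → walks (suc t) (x , red) + walks (suc t) (x , blue))
      ≡⟨ ∑-states (walks (suc t)) ⟨
    ∑ states (walks (suc t)) ∎
    where
    open ≡-Reasoning
    byColour : ∀ a e y → ⟦ a ⟧ * walks t (y , opposite e)
                       ≡ ⟦ a ∧ (e ≟ᶜ red) ⟧ * walks t (y , blue) + ⟦ a ∧ (e ≟ᶜ blue) ⟧ * walks t (y , red)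
    byColour true  red  y = sym (+-identityʳ _)
    byColour true  blue y = refl
    byColour false e    y = refl

-- The bound and its equality case for colourings, with the denominator `2 ^ t` cleared.

theorem1p3 : (n t : ℕ) → 1 ≤ n → 1 ≤ t →
    ((c : Colouring n) → IsRedBlueKn c →
    numAltWalks c t * 2 ^ t ≤ 2 * n * (n ∸ 1) ^ t)
    × ((c : Colouring n) → IsRedBlueKn c →
    ((v : Fin n) → (2 * redDeg c v ≡ n ∸ 1) × (2 * blueDeg c v ≡ n ∸ 1)) →
    numAltWalks c t * 2 ^ t ≡ 2 * n * (n ∸ 1) ^ t)
theorem1p3 n (suc t) _ (s≤s _) = bound , equality
  where
  scaled : ∀ c → numAltWalks c (suc t) * 2 ^ suc t
               ≡ 2 ^ suc t * ∑ (Alternating.states c) (Alternating.walks c (suc t))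
  scaled c = trans (cong (_* 2 ^ suc t) (Alternating.numAltWalks-∑ c t))
    (*-comm (∑ (Alternating.states c) (Alternating.walks c (suc t))) (2 ^ suc t))

  bound : ∀ c → IsRedBlueKn c → numAltWalks c (suc t) * 2 ^ suc t ≤ 2 * n * (n ∸ 1) ^ suc t
  bound c symm = subst₂ _≤_ (sym (scaled c)) (cong (_* (n ∸ 1) ^ suc t) length-states)
    (walks-bound (row+col-sum symm) t)
    where open Alternating c

  equality : ∀ c → IsRedBlueKn c →
    (∀ v → (2 * redDeg c v ≡ n ∸ 1) × (2 * blueDeg c v ≡ n ∸ 1)) →
    numAltWalks c (suc t) * 2 ^ suc t ≡ 2 * n * (n ∸ 1) ^ suc t
  equality c symm reg = begin
    numAltWalks c (suc t) * 2 ^ suc t             ≡⟨ scaled c ⟩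
    2 ^ suc t * ∑ states (walks (suc t))          ≡⟨ ∑-*ˡ states (2 ^ suc t) (walks (suc t)) ⟨
    -- Each row sum is a colour degree, here half of `n ∸ 1`, so all `2 * n` states contribute the
    -- same amount.
    ∑ states (λ s → 2 ^ suc t * walks (suc t) s)  ≡⟨ ∑-cong states (walks-regular halves (suc t)) ⟩
    ∑ states (λ _ → (n ∸ 1) ^ suc t)              ≡⟨ ∑-const states _ ⟩
    length states * (n ∸ 1) ^ suc t               ≡⟨ cong (_* (n ∸ 1) ^ suc t) length-states ⟩
    2 * n * (n ∸ 1) ^ suc t                       ∎
    where
    open ≡-Reasoning
    open Alternating c
    halves : ∀ s → 2 * rowSum s ≡ n ∸ 1
    halves (v , red)  = trans (cong (2 *_) (rowSum-degree v red)) (proj₁ (reg v))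
    halves (v , blue) = trans (cong (2 *_) (rowSum-degree v blue)) (proj₂ (reg v))
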